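{- Let $n\ge 2$ be an integer with square-free part $n_0$. Then $$\tilde Q_n=\frac{n}{n_0}\,\tilde Q_{n_0}.$$
   Context: Let $p_1<\dots<p_r$ be the distinct primes dividing $n$ and let $n_0=p_1p_2\cdots p_r$ (called the square-free part of $n$). The divisors of $n_0$ are ordered as $(d_1,\dots,d_{2^r})$ recursively: for $r=1$ the order is $(1,p_1)$, and for $r$ primes the first $2^{r-1}$ entries are those for the primes $p_1,\dots,p_{r-1}$, the remaining $2^{r-1}$ entries being obtained by multiplying each of these, in order, by $p_r$. In particular $d_1=1$ and $d_{2^r}=n_0$. For a divisor $d$ of $n_0$, $[d]=\{a\in\{0,1,\dots,n-1\}:\gcd(a,n_0)=d\}$ (with $\gcd(0,n_0)=n_0$), and $a_i=|[d_{i+1}]|$ for $1\le i\le 2^r-1$. $\tilde Q_n$ is the symmetric real $2^r\times 2^r$ matrix whose $(1,1)$ entry is $\varphi(n)$, whose other diagonal entries are $0$, and whose off-diagonal entries are $\rho_{i,j}$, where $\rho_{1,j}=\rho_{j,1}=\sqrt{\varphi(n)a_{j-1}}$ for $j\ge2$, and for $i\neq j$ with $i,j\ge 2$, $\rho_{i,j}=\sqrt{a_{i-1}a_{j-1}}$ if $\gcd(d_i,d_j)=1$ and $\rho_{i,j}=0$ otherwise. $\tilde Q_{n_0}$ is the same matrix constructed for $n_0$ in place of $n$ (same primes, same ordering of divisors). $\varphi$ is Euler's totient function. -}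

module Defs where

open import Data.Fin as Fin using (Fin; toℕ; cast)
open import Data.Integer as ℤ using (+_; +[1+_])
import Data.Integer.Properties as ℤ
open import Data.List using (List; []; _∷_; length; filter; upTo; downFrom; applyUpTo)
open import Data.List.Relation.Unary.All as All using ()
open import Data.List.Relation.Unary.All.Properties using (all-filter)
open import Data.Nat as ℕ using (ℕ; zero; suc; _^_; z≤n; s≤s)
import Data.Nat.Properties as ℕ
open import Data.Nat.Coprimality using (coprime?)
open import Data.Nat.Divisibility using (_∣?_)
open import Data.Nat.GCD using (gcd)
open import Data.Nat.ListAction using (product)
open import Data.Nat.ListAction.Properties using (product≢0)
open import Data.Nat.Primality using (prime?; prime⇒nonZero)
open import Data.Nat.Solver using (module +-*-Solver)
open import Data.Product using (Σ; ∃; _×_; _,_; proj₁; proj₂)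
open import Data.Rational as ℚ using (ℚ; mkℚ; 0ℚ; 1ℚ; ½; ∣_∣)
import Data.Rational.Properties as ℚ
open import Data.Rational.Solver using () renaming (module +-*-Solver to ℚ-Solver)
import Data.Rational.Unnormalised as ℚᵘ
import Data.Rational.Unnormalised.Properties as ℚᵘ
open import Data.Sum using (inj₁; inj₂)
open import Data.Vec as Vec using (Vec; []; _∷_; _++_; lookup)
open import Relation.Binary.PropositionalEquality using (_≡_; refl; sym; trans; cong; cong₂; subst)
open import Relation.Nullary using (yes; no)
open import Relation.Nullary.Decidable using (_×-dec_)

frac-≤ : ∀ a b c d .{{_ : ℕ.NonZero b}} .{{_ : ℕ.NonZero d}} →
         a ℕ.* d ℕ.≤ c ℕ.* b → (+ a) ℚ./ b ℚ.≤ (+ c) ℚ./ d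
frac-≤ a (suc b) c (suc d) h = ℚ.toℚᵘ-cancel-≤ (begin
  ℚ.toℚᵘ ((+ a) ℚ./ suc b)  ≃⟨ ℚ.toℚᵘ-fromℚᵘ (ℚᵘ.mkℚᵘ (+ a) b) ⟩
  ℚᵘ.mkℚᵘ (+ a) b           ≤⟨ ℚᵘ.*≤* lem ⟩
  ℚᵘ.mkℚᵘ (+ c) d           ≃⟨ ℚ.toℚᵘ-fromℚᵘ (ℚᵘ.mkℚᵘ (+ c) d) ⟨
  ℚ.toℚᵘ ((+ c) ℚ./ suc d)  ∎)
  where
  open ℚᵘ.≤-Reasoning
  lem : (+ a) ℤ.* (+ suc d) ℤ.≤ (+ c) ℤ.* (+ suc b)
  lem rewrite sym (ℤ.pos-* a (suc d)) | sym (ℤ.pos-* c (suc b)) = ℤ.+≤+ h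

frac-+ : ∀ a b c d .{{_ : ℕ.NonZero b}} .{{_ : ℕ.NonZero d}} .{{_ : ℕ.NonZero (b ℕ.* d)}} →
         (+ a) ℚ./ b ℚ.+ (+ c) ℚ./ d ≡ (+ (a ℕ.* d ℕ.+ c ℕ.* b)) ℚ./ (b ℕ.* d)
frac-+ a (suc b) c (suc d) = ℚ.toℚᵘ-injective (begin-equality
  ℚ.toℚᵘ ((+ a) ℚ./ suc b ℚ.+ (+ c) ℚ./ suc d)
    ≃⟨ ℚ.toℚᵘ-homo-+ ((+ a) ℚ./ suc b) ((+ c) ℚ./ suc d) ⟩
  ℚ.toℚᵘ ((+ a) ℚ./ suc b) ℚᵘ.+ ℚ.toℚᵘ ((+ c) ℚ./ suc d)
    ≃⟨ ℚᵘ.+-cong (ℚ.toℚᵘ-fromℚᵘ (ℚᵘ.mkℚᵘ (+ a) b)) (ℚ.toℚᵘ-fromℚᵘ (ℚᵘ.mkℚᵘ (+ c) d)) ⟩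
  ℚᵘ.mkℚᵘ (+ a) b ℚᵘ.+ ℚᵘ.mkℚᵘ (+ c) d
    ≡⟨ cong (λ z → ℚᵘ.mkℚᵘ z (d ℕ.+ b ℕ.* suc d)) lem ⟩
  ℚᵘ.mkℚᵘ (+ (a ℕ.* suc d ℕ.+ c ℕ.* suc b)) (d ℕ.+ b ℕ.* suc d)
    ≃⟨ ℚ.toℚᵘ-fromℚᵘ (ℚᵘ.mkℚᵘ (+ (a ℕ.* suc d ℕ.+ c ℕ.* suc b)) (d ℕ.+ b ℕ.* suc d)) ⟨
  ℚ.toℚᵘ ((+ (a ℕ.* suc d ℕ.+ c ℕ.* suc b)) ℚ./ (suc b ℕ.* suc d)) ∎)
  where
  open ℚᵘ.≤-Reasoning
  lem : (+ a) ℤ.* (+ suc d) ℤ.+ (+ c) ℤ.* (+ suc b) ≡ + (a ℕ.* suc d ℕ.+ c ℕ.* suc b)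
  lem rewrite sym (ℤ.pos-* a (suc d)) | sym (ℤ.pos-* c (suc b)) = refl

frac-* : ∀ a b c d .{{_ : ℕ.NonZero b}} .{{_ : ℕ.NonZero d}} .{{_ : ℕ.NonZero (b ℕ.* d)}} →
         ((+ a) ℚ./ b) ℚ.* ((+ c) ℚ./ d) ≡ (+ (a ℕ.* c)) ℚ./ (b ℕ.* d)
frac-* a (suc b) c (suc d) = ℚ.toℚᵘ-injective (begin-equality
  ℚ.toℚᵘ (((+ a) ℚ./ suc b) ℚ.* ((+ c) ℚ./ suc d))
    ≃⟨ ℚ.toℚᵘ-homo-* ((+ a) ℚ./ suc b) ((+ c) ℚ./ suc d) ⟩
  ℚ.toℚᵘ ((+ a) ℚ./ suc b) ℚᵘ.* ℚ.toℚᵘ ((+ c) ℚ./ suc d)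
    ≃⟨ ℚᵘ.*-cong (ℚ.toℚᵘ-fromℚᵘ (ℚᵘ.mkℚᵘ (+ a) b)) (ℚ.toℚᵘ-fromℚᵘ (ℚᵘ.mkℚᵘ (+ c) d)) ⟩
  ℚᵘ.mkℚᵘ (+ a) b ℚᵘ.* ℚᵘ.mkℚᵘ (+ c) d
    ≡⟨ cong (λ z → ℚᵘ.mkℚᵘ z (d ℕ.+ b ℕ.* suc d)) (sym (ℤ.pos-* a c)) ⟩
  ℚᵘ.mkℚᵘ (+ (a ℕ.* c)) (d ℕ.+ b ℕ.* suc d)
    ≃⟨ ℚ.toℚᵘ-fromℚᵘ (ℚᵘ.mkℚᵘ (+ (a ℕ.* c)) (d ℕ.+ b ℕ.* suc d)) ⟨
  ℚ.toℚᵘ ((+ (a ℕ.* c)) ℚ./ (suc b ℕ.* suc d)) ∎)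
  where open ℚᵘ.≤-Reasoning

p≤q+r⇒p-q≤r : ∀ {p q r} → p ℚ.≤ q ℚ.+ r → p ℚ.- q ℚ.≤ r
p≤q+r⇒p-q≤r {p} {q} {r} h = begin
  p ℚ.- q            ≤⟨ ℚ.+-monoˡ-≤ (ℚ.- q) h ⟩
  q ℚ.+ r ℚ.- q      ≡⟨ solve 2 (λ q r → q :+ r :- q := r) refl q r ⟩
  r                  ∎
  where
  open ℚ.≤-Reasoning
  open ℚ-Solver

∣-∣-≤ : ∀ {p q r} → p ℚ.≤ q ℚ.+ r → q ℚ.≤ p ℚ.+ r → ∣ p ℚ.- q ∣ ℚ.≤ r
∣-∣-≤ {p} {q} {r} h₁ h₂ with ℚ.∣p∣≡p∨∣p∣≡-p (p ℚ.- q)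
... | inj₁ e = subst (ℚ._≤ r) (sym e) (p≤q+r⇒p-q≤r h₁)
... | inj₂ e = subst (ℚ._≤ r) (sym (trans e swap)) (p≤q+r⇒p-q≤r h₂)
  where
  open ℚ-Solver
  swap : ℚ.- (p ℚ.- q) ≡ q ℚ.- p
  swap = solve 2 (λ p q → :- (p :- q) := q :- p) refl p q

-- Real numbers are Cauchy sequences of rationals, with _≈_ as their equality.

Cauchy : (ℕ → ℚ) → Set
Cauchy x = ∀ ε → 0ℚ ℚ.< ε →
  ∃ λ N → ∀ m n → N ℕ.≤ m → N ℕ.≤ n → ∣ x m ℚ.- x n ∣ ℚ.≤ ε

record ℝ : Set where
  constructor mkℝ
  field
    seq    : ℕ → ℚ
    cauchy : Cauchy seq

open ℝ public

infix 4 _≈_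

_≈_ : ℝ → ℝ → Set
x ≈ y = ∀ ε → 0ℚ ℚ.< ε → ∃ λ N → ∀ n → N ℕ.≤ n → ∣ seq x n ℚ.- seq y n ∣ ℚ.≤ ε

fromℚ : ℚ → ℝ
fromℚ q = mkℝ (λ _ → q) λ ε 0<ε → 0 , λ _ _ _ _ →
  subst (λ z → ∣ z ∣ ℚ.≤ ε) (sym (ℚ.+-inverseʳ q)) (ℚ.<⇒≤ 0<ε)

fromℕ : ℕ → ℝ
fromℕ k = fromℚ ((+ k) ℚ./ 1)

bounded : ∀ x → Cauchy x → ∃ λ N → ∃ λ B → ℚ.Positive B × (∀ n → N ℕ.≤ n → ∣ x n ∣ ℚ.≤ B)
bounded x cx =
  N , ∣ x N ∣ ℚ.+ 1ℚ , ℚ.nonNeg+pos⇒pos ∣ x N ∣ {{ℚ.∣-∣-nonNeg (x N)}} 1ℚ , λ n N≤n → begin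
    ∣ x n ∣                        ≡⟨ cong ∣_∣ (solve 2 (λ a b → a := b :+ (a :- b)) refl (x n) (x N)) ⟩
    ∣ x N ℚ.+ (x n ℚ.- x N) ∣      ≤⟨ ℚ.∣p+q∣≤∣p∣+∣q∣ (x N) (x n ℚ.- x N) ⟩
    ∣ x N ∣ ℚ.+ ∣ x n ℚ.- x N ∣    ≤⟨ ℚ.+-monoʳ-≤ ∣ x N ∣ (h n N N≤n ℕ.≤-refl) ⟩
    ∣ x N ∣ ℚ.+ 1ℚ                 ∎
  where
  open ℚ.≤-Reasoning
  open ℚ-Solver
  c1 = cx 1ℚ (ℚ.positive⁻¹ 1ℚ)
  N  = proj₁ c1
  h  = proj₂ c1

∣*∣-≤ : ∀ p q {a b} .{{_ : ℚ.NonNegative a}} → ∣ p ∣ ℚ.≤ a → ∣ q ∣ ℚ.≤ b → ∣ p ℚ.* q ∣ ℚ.≤ a ℚ.* b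
∣*∣-≤ p q {a} {b} h₁ h₂ = begin
  ∣ p ℚ.* q ∣      ≡⟨ ℚ.∣p*q∣≡∣p∣*∣q∣ p q ⟩
  ∣ p ∣ ℚ.* ∣ q ∣  ≤⟨ ℚ.*-monoʳ-≤-nonNeg ∣ q ∣ {{ℚ.∣-∣-nonNeg q}} h₁ ⟩
  a ℚ.* ∣ q ∣      ≤⟨ ℚ.*-monoˡ-≤-nonNeg a h₂ ⟩
  a ℚ.* b          ∎
  where open ℚ.≤-Reasoning

*-diff : ∀ a b c d → a ℚ.* b ℚ.- c ℚ.* d ≡ a ℚ.* (b ℚ.- d) ℚ.+ d ℚ.* (a ℚ.- c)
*-diff = solve 4 (λ a b c d → a :* b :- c :* d := a :* (b :- d) :+ d :* (a :- c)) refl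
  where open ℚ-Solver

*-swap : ∀ a b c → a ℚ.* (b ℚ.* c) ≡ b ℚ.* (a ℚ.* c)
*-swap = solve 3 (λ a b c → a :* (b :* c) := b :* (a :* c)) refl
  where open ℚ-Solver

half+half : ∀ p → ½ ℚ.* p ℚ.+ ½ ℚ.* p ≡ p
half+half p = trans (sym (ℚ.*-distribʳ-+ p ½ ½)) (ℚ.*-identityˡ p)

*-diff-≤ : ∀ a b c d {A D β γ ε} → ℚ.Positive A → ℚ.Positive D →
           ∣ a ∣ ℚ.≤ A → ∣ d ∣ ℚ.≤ D → ∣ b ℚ.- d ∣ ℚ.≤ β → ∣ a ℚ.- c ∣ ℚ.≤ γ →
           A ℚ.* β ≡ ½ ℚ.* ε → D ℚ.* γ ≡ ½ ℚ.* ε →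
           ∣ a ℚ.* b ℚ.- c ℚ.* d ∣ ℚ.≤ ε
*-diff-≤ a b c d {A} {D} {β} {γ} {ε} A>0 D>0 hA hD hβ hγ eβ eγ = begin
  ∣ a ℚ.* b ℚ.- c ℚ.* d ∣                            ≡⟨ cong ∣_∣ (*-diff a b c d) ⟩
  ∣ a ℚ.* (b ℚ.- d) ℚ.+ d ℚ.* (a ℚ.- c) ∣            ≤⟨ ℚ.∣p+q∣≤∣p∣+∣q∣ (a ℚ.* (b ℚ.- d)) (d ℚ.* (a ℚ.- c)) ⟩
  ∣ a ℚ.* (b ℚ.- d) ∣ ℚ.+ ∣ d ℚ.* (a ℚ.- c) ∣        ≤⟨ ℚ.+-mono-≤
                                                          (∣*∣-≤ a (b ℚ.- d) {{ℚ.pos⇒nonNeg A {{A>0}}}} hA hβ)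
                                                          (∣*∣-≤ d (a ℚ.- c) {{ℚ.pos⇒nonNeg D {{D>0}}}} hD hγ) ⟩
  A ℚ.* β ℚ.+ D ℚ.* γ                                ≡⟨ cong₂ ℚ._+_ eβ eγ ⟩
  ½ ℚ.* ε ℚ.+ ½ ℚ.* ε                                ≡⟨ half+half ε ⟩
  ε                                                  ∎
  where open ℚ.≤-Reasoning

half-quotient : ∀ ε B → 0ℚ ℚ.< ε → ℚ.Positive B → ∃ λ δ → 0ℚ ℚ.< δ × B ℚ.* δ ≡ ½ ℚ.* ε
half-quotient ε B 0<ε B>0 = ½ ℚ.* ε ℚ.* B⁻¹ , 0<δ , trans (*-swap B (½ ℚ.* ε) B⁻¹)
    (trans (cong (½ ℚ.* ε ℚ.*_) (ℚ.*-inverseʳ B {{B≢0}})) (ℚ.*-identityʳ (½ ℚ.* ε)))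
  where
  B≢0 = ℚ.pos⇒nonZero B {{B>0}}
  B⁻¹ = (ℚ.1/ B) {{B≢0}}
  0<δ : 0ℚ ℚ.< ½ ℚ.* ε ℚ.* B⁻¹
  0<δ = ℚ.positive⁻¹ (½ ℚ.* ε ℚ.* B⁻¹)
    {{ℚ.pos*pos⇒pos (½ ℚ.* ε) {{ℚ.pos*pos⇒pos ½ ε {{ℚ.positive 0<ε}}}} B⁻¹ {{ℚ.1/pos⇒pos B {{B>0}}}}}}

Cauchy-* : ∀ x y → Cauchy x → Cauchy y → Cauchy (λ n → x n ℚ.* y n)
Cauchy-* x y cx cy ε 0<ε =
  let Nx , A , A>0 , hA = bounded x cx
      Ny , D , D>0 , hD = bounded y cy
      β , 0<β , eβ      = half-quotient ε A 0<ε A>0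
      γ , 0<γ , eγ      = half-quotient ε D 0<ε D>0
      My , hβ           = cy β 0<β
      Mx , hγ           = cx γ 0<γ
      N                 = (Nx ℕ.⊔ Ny) ℕ.⊔ (Mx ℕ.⊔ My)
  in N , λ m n N≤m N≤n →
    *-diff-≤ (x m) (y m) (x n) (y n) A>0 D>0
      (hA m (ℕ.m⊔n≤o⇒m≤o Nx Ny (ℕ.m⊔n≤o⇒m≤o (Nx ℕ.⊔ Ny) (Mx ℕ.⊔ My) N≤m)))
      (hD n (ℕ.m⊔n≤o⇒n≤o Nx Ny (ℕ.m⊔n≤o⇒m≤o (Nx ℕ.⊔ Ny) (Mx ℕ.⊔ My) N≤n)))
      (hβ m n (ℕ.m⊔n≤o⇒n≤o Mx My (ℕ.m⊔n≤o⇒n≤o (Nx ℕ.⊔ Ny) (Mx ℕ.⊔ My) N≤m))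
              (ℕ.m⊔n≤o⇒n≤o Mx My (ℕ.m⊔n≤o⇒n≤o (Nx ℕ.⊔ Ny) (Mx ℕ.⊔ My) N≤n)))
      (hγ m n (ℕ.m⊔n≤o⇒m≤o Mx My (ℕ.m⊔n≤o⇒n≤o (Nx ℕ.⊔ Ny) (Mx ℕ.⊔ My) N≤m))
              (ℕ.m⊔n≤o⇒m≤o Mx My (ℕ.m⊔n≤o⇒n≤o (Nx ℕ.⊔ Ny) (Mx ℕ.⊔ My) N≤n)))
      eβ eγ

infixl 7 _*ᴿ_

_*ᴿ_ : ℝ → ℝ → ℝ
x *ᴿ y = mkℝ (λ n → seq x n ℚ.* seq y n) (Cauchy-* (seq x) (seq y) (cauchy x) (cauchy y))

⌊√_⌋ : ℕ → ℕ
⌊√ zero ⌋ = 0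
⌊√ suc k ⌋ with suc ⌊√ k ⌋ ℕ.* suc ⌊√ k ⌋ ℕ.≤? suc k
... | yes _ = suc ⌊√ k ⌋
... | no  _ = ⌊√ k ⌋

⌊√⌋-lower : ∀ k → ⌊√ k ⌋ ℕ.* ⌊√ k ⌋ ℕ.≤ k
⌊√⌋-lower zero = z≤n
⌊√⌋-lower (suc k) with suc ⌊√ k ⌋ ℕ.* suc ⌊√ k ⌋ ℕ.≤? suc k
... | yes h = h
... | no  _ = ℕ.m≤n⇒m≤1+n (⌊√⌋-lower k)

⌊√⌋-upper : ∀ k → k ℕ.< suc ⌊√ k ⌋ ℕ.* suc ⌊√ k ⌋
⌊√⌋-upper zero = s≤s z≤n
⌊√⌋-upper (suc k) with suc ⌊√ k ⌋ ℕ.* suc ⌊√ k ⌋ ℕ.≤? suc k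
... | yes _ = ℕ.≤-<-trans (⌊√⌋-upper k) (ℕ.*-mono-< (ℕ.n<1+n (suc ⌊√ k ⌋)) (ℕ.n<1+n (suc ⌊√ k ⌋)))
... | no  h = ℕ.≰⇒> h

m²≤n²⇒m≤n : ∀ m n → m ℕ.* m ℕ.≤ n ℕ.* n → m ℕ.≤ n
m²≤n²⇒m≤n m n h with m ℕ.≤? n
... | yes m≤n = m≤n
... | no  m≰n = contra (ℕ.≤⇒≯ h (ℕ.*-mono-< (ℕ.≰⇒> m≰n) (ℕ.≰⇒> m≰n)))
  where open import Data.Empty using () renaming (⊥-elim to contra)

√-num : ℕ → ℕ → ℕ
√-num k m = ⌊√ k ℕ.* (suc m ℕ.* suc m) ⌋

√-seq : ℕ → ℕ → ℚ
√-seq k m = (+ √-num k m) ℚ./ suc m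

1/[1+_] : ℕ → ℚ
1/[1+ m ] = (+ 1) ℚ./ suc m

√-seq-≤ : ∀ k m l → √-seq k m ℚ.≤ √-seq k l ℚ.+ 1/[1+ l ]
√-seq-≤ k m l = begin
  √-seq k m                                         ≤⟨ frac-≤ s M (suc t) L le ⟩
  (+ suc t) ℚ./ L                                   ≤⟨ frac-≤ (suc t) L (t ℕ.* L ℕ.+ 1 ℕ.* L) (L ℕ.* L) eq ⟩
  (+ (t ℕ.* L ℕ.+ 1 ℕ.* L)) ℚ./ (L ℕ.* L)           ≡⟨ frac-+ t L 1 L ⟨
  √-seq k l ℚ.+ 1/[1+ l ]                           ∎
  where
  open ℚ.≤-Reasoning
  M = suc m
  L = suc l
  s = √-num k m
  t = √-num k l
  open +-*-Solver
  eq : suc t ℕ.* (L ℕ.* L) ℕ.≤ (t ℕ.* L ℕ.+ 1 ℕ.* L) ℕ.* L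
  eq = ℕ.≤-reflexive (solve 2 (λ t L → (con 1 :+ t) :* (L :* L) := (t :* L :+ con 1 :* L) :* L) refl t L)
  le : s ℕ.* L ℕ.≤ suc t ℕ.* M
  le = m²≤n²⇒m≤n (s ℕ.* L) (suc t ℕ.* M) (R.begin
    (s ℕ.* L) ℕ.* (s ℕ.* L)              R.≡⟨ ℕ.[m*n]*[o*p]≡[m*o]*[n*p] s L s L ⟩
    (s ℕ.* s) ℕ.* (L ℕ.* L)              R.≤⟨ ℕ.*-monoˡ-≤ (L ℕ.* L) (⌊√⌋-lower (k ℕ.* (M ℕ.* M))) ⟩
    (k ℕ.* (M ℕ.* M)) ℕ.* (L ℕ.* L)      R.≡⟨ solve 3 (λ k M L → (k :* M) :* L := (k :* L) :* M) refl k (M ℕ.* M) (L ℕ.* L) ⟩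
    (k ℕ.* (L ℕ.* L)) ℕ.* (M ℕ.* M)      R.≤⟨ ℕ.*-monoˡ-≤ (M ℕ.* M) (ℕ.<⇒≤ (⌊√⌋-upper (k ℕ.* (L ℕ.* L)))) ⟩
    (suc t ℕ.* suc t) ℕ.* (M ℕ.* M)      R.≡⟨ ℕ.[m*n]*[o*p]≡[m*o]*[n*p] (suc t) (suc t) M M ⟩
    (suc t ℕ.* M) ℕ.* (suc t ℕ.* M)      R.∎)
    where module R = ℕ.≤-Reasoning

archimedean : ∀ c ε → 0ℚ ℚ.< ε → ∃ λ N → ∀ n → N ℕ.≤ n → (+ c) ℚ./ suc n ℚ.≤ ε
archimedean c ε 0<ε with ε | ℚ.positive 0<ε
... | mkℚ (+[1+ p ]) d cop | _ = c ℕ.* suc d , λ n N≤n →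
  subst ((+ c) ℚ./ suc n ℚ.≤_) (ℚ.fromℚᵘ-toℚᵘ (mkℚ (+[1+ p ]) d cop))
    (frac-≤ c (suc n) (suc p) (suc d)
      (ℕ.≤-trans N≤n (ℕ.≤-trans (ℕ.n≤1+n n) (ℕ.m≤n*m (suc n) (suc p)))))

√-cauchy : ∀ k → Cauchy (√-seq k)
√-cauchy k ε 0<ε with archimedean 1 ε 0<ε
... | N , h = N , λ m n N≤m N≤n → ∣-∣-≤
  (ℚ.≤-trans (√-seq-≤ k m n) (ℚ.+-monoʳ-≤ (√-seq k n) (h n N≤n)))
  (ℚ.≤-trans (√-seq-≤ k n m) (ℚ.+-monoʳ-≤ (√-seq k m) (h m N≤m)))

√ : ℕ → ℝ
√ k = mkℝ (√-seq k) (√-cauchy k)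

√-nonNeg : ∀ k m → 0ℚ ℚ.≤ seq (√ k) m
√-nonNeg k m = frac-≤ 0 1 (√-num k m) (suc m) z≤n

√-square : ∀ k → √ k *ᴿ √ k ≈ fromℕ k
√-square k ε 0<ε with archimedean (suc (2 ℕ.* k)) ε 0<ε
... | N , h = N , λ n N≤n → ∣-∣-≤ (lower n) (ℚ.≤-trans (upper n)
    (ℚ.+-monoʳ-≤ (√-seq k n ℚ.* √-seq k n) (h n N≤n)))
  where
  open ℚ.≤-Reasoning
  open +-*-Solver

  lower : ∀ n → √-seq k n ℚ.* √-seq k n ℚ.≤ (+ k) ℚ./ 1 ℚ.+ ε
  lower n = begin
    √-seq k n ℚ.* √-seq k n             ≡⟨ frac-* s M s M ⟩
    (+ (s ℕ.* s)) ℚ./ (M ℕ.* M)         ≤⟨ frac-≤ (s ℕ.* s) (M ℕ.* M) k 1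
                                             (subst (ℕ._≤ k ℕ.* (M ℕ.* M)) (sym (ℕ.*-identityʳ (s ℕ.* s)))
                                               (⌊√⌋-lower (k ℕ.* (M ℕ.* M)))) ⟩
    (+ k) ℚ./ 1                         ≡⟨ ℚ.+-identityʳ _ ⟨
    (+ k) ℚ./ 1 ℚ.+ 0ℚ                  ≤⟨ ℚ.+-monoʳ-≤ ((+ k) ℚ./ 1) (ℚ.<⇒≤ 0<ε) ⟩
    (+ k) ℚ./ 1 ℚ.+ ε                   ∎
    where
    M = suc n
    s = √-num k n

  upper : ∀ n → (+ k) ℚ./ 1 ℚ.≤ √-seq k n ℚ.* √-seq k n ℚ.+ (+ suc (2 ℕ.* k)) ℚ./ suc n
  upper n = begin
    (+ k) ℚ./ 1
      ≤⟨ frac-≤ k 1 (s ℕ.* s ℕ.* M ℕ.+ suc (2 ℕ.* k) ℕ.* (M ℕ.* M)) (M ℕ.* M ℕ.* M) le ⟩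
    (+ (s ℕ.* s ℕ.* M ℕ.+ suc (2 ℕ.* k) ℕ.* (M ℕ.* M))) ℚ./ (M ℕ.* M ℕ.* M)
      ≡⟨ frac-+ (s ℕ.* s) (M ℕ.* M) (suc (2 ℕ.* k)) M ⟨
    (+ (s ℕ.* s)) ℚ./ (M ℕ.* M) ℚ.+ (+ suc (2 ℕ.* k)) ℚ./ M
      ≡⟨ cong (ℚ._+ (+ suc (2 ℕ.* k)) ℚ./ M) (frac-* s M s M) ⟨
    √-seq k n ℚ.* √-seq k n ℚ.+ (+ suc (2 ℕ.* k)) ℚ./ M ∎
    where
    M = suc n
    s = √-num k n
    module R = ℕ.≤-Reasoning
    s≤kM : s ℕ.≤ k ℕ.* M
    s≤kM = m²≤n²⇒m≤n s (k ℕ.* M) (R.begin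
      s ℕ.* s                    R.≤⟨ ⌊√⌋-lower (k ℕ.* (M ℕ.* M)) ⟩
      k ℕ.* (M ℕ.* M)            R.≤⟨ ℕ.*-monoˡ-≤ (M ℕ.* M) (k≤k² k) ⟩
      (k ℕ.* k) ℕ.* (M ℕ.* M)    R.≡⟨ ℕ.[m*n]*[o*p]≡[m*o]*[n*p] k k M M ⟩
      (k ℕ.* M) ℕ.* (k ℕ.* M)    R.∎)
      where
      k≤k² : ∀ k → k ℕ.≤ k ℕ.* k
      k≤k² zero    = z≤n
      k≤k² (suc k) = ℕ.m≤m*n (suc k) (suc k)
    le : k ℕ.* (M ℕ.* M ℕ.* M) ℕ.≤ (s ℕ.* s ℕ.* M ℕ.+ suc (2 ℕ.* k) ℕ.* (M ℕ.* M)) ℕ.* 1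
    le = R.begin
      k ℕ.* (M ℕ.* M ℕ.* M)
        R.≡⟨ solve 2 (λ k M → k :* (M :* M :* M) := k :* (M :* M) :* M) refl k M ⟩
      k ℕ.* (M ℕ.* M) ℕ.* M
        R.≤⟨ ℕ.*-monoˡ-≤ M (ℕ.<⇒≤ (⌊√⌋-upper (k ℕ.* (M ℕ.* M)))) ⟩
      suc s ℕ.* suc s ℕ.* M
        R.≡⟨ solve 2 (λ s M → (con 1 :+ s) :* (con 1 :+ s) :* M := (s :* s :+ con 2 :* s :+ con 1) :* M) refl s M ⟩
      (s ℕ.* s ℕ.+ 2 ℕ.* s ℕ.+ 1) ℕ.* M
        R.≤⟨ ℕ.*-monoˡ-≤ M (ℕ.+-mono-≤ (ℕ.+-monoʳ-≤ (s ℕ.* s) (ℕ.*-monoʳ-≤ 2 s≤kM)) (s≤s z≤n)) ⟩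
      (s ℕ.* s ℕ.+ 2 ℕ.* (k ℕ.* M) ℕ.+ M) ℕ.* M
        R.≡⟨ solve 3 (λ s k M → (s :* s :+ con 2 :* (k :* M) :+ M) :* M
                              := (s :* s :* M :+ (con 1 :+ con 2 :* k) :* (M :* M)) :* con 1) refl s k M ⟩
      (s ℕ.* s ℕ.* M ℕ.+ suc (2 ℕ.* k) ℕ.* (M ℕ.* M)) ℕ.* 1 R.∎

-- p_r, …, p_1: the largest prime comes first, because the recursive ordering
-- of the divisors below splits off p_r.
primeDivisors : ℕ → List ℕ
primeDivisors n = filter (λ p → prime? p ×-dec (p ∣? n)) (downFrom (suc n))

n₀ : ℕ → ℕ
n₀ n = product (primeDivisors n)

n₀-nonZero : ∀ n → ℕ.NonZero (n₀ n)
n₀-nonZero n = product≢0 (All.map (λ h → prime⇒nonZero (proj₁ h))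
  (all-filter (λ p → prime? p ×-dec (p ∣? n)) (downFrom (suc n))))

ω : ℕ → ℕ
ω n = length (primeDivisors n)

-- The trailing [] matches 2 ^ suc r = 2 ^ r + (2 ^ r + 0).
orderedDivisors : (ps : List ℕ) → Vec ℕ (2 ^ length ps)
orderedDivisors []       = 1 ∷ []
orderedDivisors (p ∷ ps) = orderedDivisors ps ++ (Vec.map (ℕ._* p) (orderedDivisors ps) ++ [])

d : ∀ n → Fin (2 ^ ω n) → ℕ
d n i = lookup (orderedDivisors (primeDivisors n)) i

gcdClass : ℕ → ℕ → List ℕ
gcdClass n δ = filter (λ a → gcd a (n₀ n) ℕ.≟ δ) (upTo n)

φ : ℕ → ℕ
φ n = length (filter (λ a → coprime? a n) (applyUpTo suc n))

-- ∣[ d_i ]∣; in 1-based indexing this is a_{i-1}.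
classSize : ∀ n → Fin (2 ^ ω n) → ℕ
classSize n i = length (gcdClass n (d n i))

Matrix : ℕ → Set
Matrix k = Fin k → Fin k → ℝ

infixr 7 _∙_

_∙_ : ∀ {k} → ℝ → Matrix k → Matrix k
(c ∙ A) i j = c *ᴿ A i j

-- The sizes need only be propositionally equal: Q̃ n and Q̃ (n₀ n) below have
-- sizes 2 ^ ω n and 2 ^ ω (n₀ n).
infix 4 _≋_

_≋_ : ∀ {k l} → Matrix k → Matrix l → Set
_≋_ {k} {l} A B = Σ (k ≡ l) λ k≡l → ∀ i j → A i j ≈ B (cast k≡l i) (cast k≡l j)

Q̃ : ∀ n → Matrix (2 ^ ω n)
Q̃ n i j with toℕ i | toℕ j
... | zero  | zero  = fromℕ (φ n)
... | zero  | suc _ = √ (φ n ℕ.* classSize n j)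
... | suc _ | zero  = √ (φ n ℕ.* classSize n i)
... | suc _ | suc _ with i Fin.≟ j | gcd (d n i) (d n j) ℕ.≟ 1
...   | yes _ | _     = fromℕ 0
...   | no  _ | yes _ = √ (classSize n i ℕ.* classSize n j)
...   | no  _ | no  _ = fromℕ 0

{-# OPTIONS --safe #-}
-- Write n = k n₀.  The numbers n and n₀ have the same prime divisors, so both
-- matrices are built from the same list of divisors d.  Whether a lies in [d], or
-- is coprime to n, depends only on gcd(a, n₀), which has period n₀ in a; hence
-- passing from n₀ to n multiplies φ and every class size by k, and every nonzero entry,
-- being the square root of a product of two such numbers, is multiplied by k.
module Submission where

open import Defs
open import Data.Nat using (ℕ; _≤_)
open import Data.Integer using (+_)
open import Data.Rational using (_/_)

open import Data.Fin as Fin using (toℕ; cast)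
open import Data.Fin.Properties using (toℕ-cast; toℕ-injective; cast-is-id)
open import Data.List using ([]; _∷_; _++_; _∷ʳ_; length; map; filter; upTo; downFrom; applyUpTo)
open import Data.List.Membership.Propositional.Properties using (∈-filter⁺; ∈-downFrom⁺)
open import Data.List.Properties using (filter-≐; filter-++; filter-reject; length-++; map-upTo; upTo-∷ʳ)
open import Data.List.Relation.Unary.All as All using (All; []; _∷_)
open import Data.List.Relation.Unary.All.Properties using (all-filter; All¬⇒¬Any)
open import Data.List.Relation.Unary.AllPairs using ([]; _∷_)
open import Data.List.Relation.Unary.Unique.Propositional using (Unique)
open import Data.List.Relation.Unary.Unique.Propositional.Properties using (downFrom⁺; filter⁺)
open import Data.Nat as ℕ using (zero; suc; _^_; _+_; _*_; _<_; NonZero; s≤s)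
open import Data.Nat.Coprimality using (Coprime; coprime?; coprime⇒gcd≡1; gcd≡1⇒coprime)
open import Data.Nat.Divisibility
open import Data.Nat.GCD using (gcd; gcd-greatest; gcd[m,n]∣m; gcd[m,n]∣n; gcd[m,n]≢0)
open import Data.Nat.ListAction using (product)
open import Data.Nat.ListAction.Properties using (∈⇒∣product)
open import Data.Nat.Primality using (Prime; prime?; ¬prime[1]; euclidsLemma)
open import Data.Nat.Primality.Factorisation using (factorise; factorisationHasAllPrimeFactors)
import Data.Nat.Properties as ℕ
open import Data.Nat.Solver using (module +-*-Solver)
open import Data.Product using (∃; _×_; _,_; proj₁; proj₂)
open import Data.Rational as ℚ using (0ℚ; ∣_∣)
import Data.Rational.Properties as ℚ
open import Data.Sum using (inj₁; inj₂)
open import Data.Vec using (lookup)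
open import Function using (_∘_; id)
open import Relation.Binary.PropositionalEquality using (_≡_; _≢_; refl; sym; trans; cong; cong₂; subst; module ≡-Reasoning)
open import Relation.Nullary using (yes; no; contradiction)
open import Relation.Nullary.Decidable using (_×-dec_)
open import Relation.Unary using (Pred; Decidable; _≐_)

-- The square-free part and its prime divisors.

-- By induction `n` is `t * product ps`. The next prime `p` divides `t` or `product ps` by Euclid's
-- lemma; in the second case unique factorisation puts `p` among `ps`, against distinctness.
product-∣ : ∀ {ps n} → Unique ps → All Prime ps → All (_∣ n) ps → product ps ∣ n
product-∣ {n = n} [] [] [] = 1∣ n
product-∣ {p ∷ ps} (p∉ps ∷ ups) (pp ∷ pps) (p∣n ∷ ps∣n)
  with divides t refl ← product-∣ ups pps ps∣n
  with euclidsLemma t (product ps) pp p∣n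
... | inj₁ p∣t  = *-monoˡ-∣ (product ps) p∣t
... | inj₂ p∣ps = contradiction (factorisationHasAllPrimeFactors pp p∣ps pps) (All¬⇒¬Any p∉ps)

primeDivisor? : ∀ n → Decidable (λ p → Prime p × p ∣ n)
primeDivisor? n p = prime? p ×-dec (p ∣? n)

primeDivisors-∣ : ∀ n → All (λ p → Prime p × p ∣ n) (primeDivisors n)
primeDivisors-∣ n = all-filter (primeDivisor? n) (downFrom (suc n))

n₀∣n : ∀ n → n₀ n ∣ n
n₀∣n n = product-∣ (filter⁺ (primeDivisor? n) (downFrom⁺ (suc n)))
  (All.map proj₁ (primeDivisors-∣ n)) (All.map proj₂ (primeDivisors-∣ n))

prime∣n⇒prime∣n₀ : ∀ n .{{_ : NonZero n}} {p} → Prime p → p ∣ n → p ∣ n₀ n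
prime∣n⇒prime∣n₀ n pp p∣n = ∈⇒∣product
  (∈-filter⁺ (primeDivisor? n) (∈-downFrom⁺ (s≤s (∣⇒≤ p∣n))) (pp , p∣n))

-- `primeDivisors n` and `primeDivisors (n₀ n)` filter ranges of different lengths. The surplus
-- numbers stand at the head of the longer range and fail `P`, so they are rejected one by one.
filter-downFrom : ∀ {ℓ} {P : Pred ℕ ℓ} (P? : Decidable P) m n → m ≤ n → (∀ {x} → P x → x < m) →
                  filter P? (downFrom n) ≡ filter P? (downFrom m)
filter-downFrom P? m n m≤n P⇒< = go n (ℕ.≤⇒≤′ m≤n)
  where
  go : ∀ n → m ℕ.≤′ n → filter P? (downFrom n) ≡ filter P? (downFrom m)
  go n ℕ.≤′-refl = refl
  go (suc n) (ℕ.≤′-step m≤n) = trans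
    (filter-reject P? (λ Pn → ℕ.<⇒≱ (P⇒< Pn) (ℕ.≤′⇒≤ m≤n))) (go n m≤n)

-- Equality as lists, not only as sets: it makes the sizes of the two matrices and the order of
-- their divisors agree.
primeDivisors-n₀ : ∀ n .{{_ : NonZero n}} → primeDivisors n ≡ primeDivisors (n₀ n)
primeDivisors-n₀ n = trans
  (filter-≐ (primeDivisor? n) (primeDivisor? (n₀ n)) same (downFrom (suc n)))
  (filter-downFrom (primeDivisor? (n₀ n)) (suc (n₀ n)) (suc n) (s≤s (∣⇒≤ (n₀∣n n)))
    (λ (_ , p∣n₀) → s≤s (∣⇒≤ {{n₀-nonZero n}} p∣n₀)))
  where
  same : (λ p → Prime p × p ∣ n) ≐ (λ p → Prime p × p ∣ n₀ n)
  same = (λ (pp , p∣n) → pp , prime∣n⇒prime∣n₀ n pp p∣n)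
       , (λ (pp , p∣n₀) → pp , ∣-trans p∣n₀ (n₀∣n n))

n₀-idem : ∀ n .{{_ : NonZero n}} → n₀ (n₀ n) ≡ n₀ n
n₀-idem n = cong product (sym (primeDivisors-n₀ n))

primeFactor : ∀ m .{{_ : NonZero m}} → m ≢ 1 → ∃ λ p → Prime p × p ∣ m
primeFactor m m≢1 with factorise m
... | record { factors = []     ; isFactorisation = m≡1 } = contradiction m≡1 m≢1
... | record { factors = p ∷ ps ; isFactorisation = m≡  ; factorsPrime = pp ∷ _ } =
  p , pp , subst (p ∣_) (sym m≡) (m∣m*n (product ps))

-- For `back`: if `gcd a n` were not 1, it would have a prime factor. That prime divides `a` and
-- also `n₀ n`, so it would be 1.
coprime⇔gcd-n₀≡1 : ∀ n .{{_ : NonZero n}} → (λ a → Coprime a n) ≐ (λ a → gcd a (n₀ n) ≡ 1)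
coprime⇔gcd-n₀≡1 n =
  (λ c → coprime⇒gcd≡1 λ (i∣a , i∣n₀) → c (i∣a , ∣-trans i∣n₀ (n₀∣n n))) , back
  where
  back : ∀ {a} → gcd a (n₀ n) ≡ 1 → Coprime a n
  back {a} e with gcd a n ℕ.≟ 1
  ... | yes g≡1 = gcd≡1⇒coprime g≡1
  ... | no  g≢1 with primeFactor (gcd a n) {{g≢0}} g≢1
    where g≢0 = ℕ.≢-nonZero (gcd[m,n]≢0 a n (inj₂ (ℕ.≢-nonZero⁻¹ n)))
  ...   | p , pp , p∣g = contradiction
    (gcd≡1⇒coprime e (∣-trans p∣g (gcd[m,n]∣m a n) , prime∣n⇒prime∣n₀ n pp (∣-trans p∣g (gcd[m,n]∣n a n))))
    (λ where refl → ¬prime[1] pp)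

-- Counting over whole periods.

count : ∀ {ℓ} {P : Pred ℕ ℓ} → Decidable P → ℕ → ℕ
count P? n = length (filter P? (upTo n))

length-filter-map : ∀ {ℓ} {P : Pred ℕ ℓ} (P? : Decidable P) (f : ℕ → ℕ) xs →
                    length (filter P? (map f xs)) ≡ length (filter (P? ∘ f) xs)
length-filter-map P? f [] = refl
length-filter-map P? f (x ∷ xs) with P? (f x)
... | yes _ = cong suc (length-filter-map P? f xs)
... | no  _ = length-filter-map P? f xs

applyUpTo-+ : ∀ (f : ℕ → ℕ) m n → applyUpTo f (m + n) ≡ applyUpTo f m ++ applyUpTo (f ∘ (m ℕ.+_)) n
applyUpTo-+ f zero    n = refl
applyUpTo-+ f (suc m) n = cong (f 0 ∷_) (applyUpTo-+ (f ∘ suc) m n)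

count-+ : ∀ {ℓ} {P : Pred ℕ ℓ} (P? : Decidable P) m n →
          count P? (m + n) ≡ count P? m + count (P? ∘ (m ℕ.+_)) n
count-+ P? m n = begin
  length (filter P? (upTo (m + n)))
    ≡⟨ cong (length ∘ filter P?) (applyUpTo-+ id m n) ⟩
  length (filter P? (upTo m ++ applyUpTo (m ℕ.+_) n))
    ≡⟨ cong length (filter-++ P? (upTo m) _) ⟩
  length (filter P? (upTo m) ++ filter P? (applyUpTo (m ℕ.+_) n))
    ≡⟨ length-++ (filter P? (upTo m)) ⟩
  count P? m + length (filter P? (applyUpTo (m ℕ.+_) n))
    ≡⟨ cong (λ xs → count P? m + length (filter P? xs)) (map-upTo (m ℕ.+_) n) ⟨
  count P? m + length (filter P? (map (m ℕ.+_) (upTo n)))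
    ≡⟨ cong (count P? m ℕ.+_) (length-filter-map P? (m ℕ.+_) (upTo n)) ⟩
  count P? m + count (P? ∘ (m ℕ.+_)) n ∎
  where open ≡-Reasoning

-- Split off the first block of length `m`; periodicity removes the shift from the remaining `k`
-- blocks.
count-periodic : ∀ {ℓ} {P : Pred ℕ ℓ} (P? : Decidable P) m → (P ∘ (m ℕ.+_)) ≐ P →
                 ∀ k → count P? (k * m) ≡ k * count P? m
count-periodic P? m per zero    = refl
count-periodic P? m per (suc k) = begin
  count P? (m + k * m)                          ≡⟨ count-+ P? m (k * m) ⟩
  count P? m + count (P? ∘ (m ℕ.+_)) (k * m)    ≡⟨ cong (λ xs → count P? m + length xs)
                                                     (filter-≐ (P? ∘ (m ℕ.+_)) P? per (upTo (k * m))) ⟩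
  count P? m + count P? (k * m)                 ≡⟨ cong (count P? m ℕ.+_) (count-periodic P? m per k) ⟩
  count P? m + k * count P? m                   ∎
  where open ≡-Reasoning

-- Reconciles the range 1, ..., n of `φ` with the range 0, ..., n - 1 of the gcd classes. Adding the
-- contribution of `n` to either side gives the count over 0, ..., n: on the left it stands in for
-- that of 0.
length-filter-shift : ∀ {ℓ} {P : Pred ℕ ℓ} (P? : Decidable P) n → (P 0 → P n) → (P n → P 0) →
                      length (filter P? (applyUpTo suc n)) ≡ count P? n
length-filter-shift P? n to from = ℕ.+-cancelʳ-≡ (length (filter P? (n ∷ []))) _ _ (begin
  length (filter P? (applyUpTo suc n)) + length (filter P? (n ∷ []))
    ≡⟨ first ⟩
  length (filter P? (upTo (suc n)))
    ≡⟨ cong (length ∘ filter P?) (upTo-∷ʳ n) ⟨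
  length (filter P? (upTo n ∷ʳ n))
    ≡⟨ cong length (filter-++ P? (upTo n) (n ∷ [])) ⟩
  length (filter P? (upTo n) ++ filter P? (n ∷ []))
    ≡⟨ length-++ (filter P? (upTo n)) ⟩
  count P? n + length (filter P? (n ∷ [])) ∎)
  where
  open ≡-Reasoning
  first : length (filter P? (applyUpTo suc n)) + length (filter P? (n ∷ []))
        ≡ length (filter P? (0 ∷ applyUpTo suc n))
  first with P? 0 | P? n
  ... | yes _  | yes _  = ℕ.+-comm _ 1
  ... | no  _  | no  _  = ℕ.+-identityʳ _
  ... | yes P0 | no ¬Pn = contradiction (to P0) ¬Pn
  ... | no ¬P0 | yes Pn = contradiction (from Pn) ¬P0

-- Scaling of the totient and of the class sizes.

gcd-+ : ∀ m a → gcd (m + a) m ≡ gcd a m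
gcd-+ m a = ∣-antisym
  (gcd-greatest (∣m+n∣m⇒∣n (gcd[m,n]∣m (m + a) m) (gcd[m,n]∣n (m + a) m)) (gcd[m,n]∣n (m + a) m))
  (gcd-greatest (∣m∣n⇒∣m+n (gcd[m,n]∣n a m) (gcd[m,n]∣m a m)) (gcd[m,n]∣n a m))

-- The modulus `m` is kept apart from the length of the range, so that the range can grow from
-- `n₀ n` to `n` under a fixed modulus. `classSize n i` unfolds to `gcdCount (n₀ n) (d n i) n`.
gcdCount : ℕ → ℕ → ℕ → ℕ
gcdCount m δ = count (λ a → gcd a m ℕ.≟ δ)

gcdCount-* : ∀ m δ k → gcdCount m δ (k * m) ≡ k * gcdCount m δ m
gcdCount-* m δ = count-periodic (λ a → gcd a m ℕ.≟ δ) m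
  ((λ {a} → trans (sym (gcd-+ m a))) , (λ {a} → trans (gcd-+ m a)))

φ≡gcdCount : ∀ n .{{_ : NonZero n}} → φ n ≡ gcdCount (n₀ n) 1 n
φ≡gcdCount n = trans
  (length-filter-shift (λ a → coprime? a n) n
    -- The endpoints 0 and `n` behave alike, as each has gcd `n` with `n`.
    (λ c (i∣n , _) → c (_ ∣0 , i∣n)) (λ c (_ , i∣n) → c (i∣n , i∣n)))
  (cong length (filter-≐ (λ a → coprime? a n) (λ a → gcd a (n₀ n) ℕ.≟ 1) (coprime⇔gcd-n₀≡1 n) (upTo n)))

φ-n₀ : ∀ n .{{_ : NonZero n}} k → n ≡ k * n₀ n → φ n ≡ k * φ (n₀ n)
φ-n₀ n k n≡ = begin
  φ n                               ≡⟨ φ≡gcdCount n ⟩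
  gcdCount (n₀ n) 1 n               ≡⟨ cong (gcdCount (n₀ n) 1) n≡ ⟩
  gcdCount (n₀ n) 1 (k * n₀ n)      ≡⟨ gcdCount-* (n₀ n) 1 k ⟩
  -- Applied to `n₀ n`, `φ≡gcdCount` has modulus `n₀ (n₀ n)`.
  k * gcdCount (n₀ n) 1 (n₀ n)      ≡⟨ cong (λ m → k * gcdCount m 1 (n₀ n)) (n₀-idem n) ⟨
  k * gcdCount (n₀ (n₀ n)) 1 (n₀ n) ≡⟨ cong (k ℕ.*_) (φ≡gcdCount (n₀ n) {{n₀-nonZero n}}) ⟨
  k * φ (n₀ n)                      ∎
  where open ≡-Reasoning

-- Stated for variable lists so that their equality can be matched with `refl`; the cast is then
-- along a reflexive equation.
lookup-orderedDivisors : ∀ {ps qs} → ps ≡ qs → .(e : 2 ^ length ps ≡ 2 ^ length qs) → ∀ i →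
  lookup (orderedDivisors ps) i ≡ lookup (orderedDivisors qs) (cast e i)
lookup-orderedDivisors {ps} refl e i = cong (lookup (orderedDivisors ps)) (sym (cast-is-id e i))

classSize-n₀ : ∀ n .{{_ : NonZero n}} k → n ≡ k * n₀ n → .(e : 2 ^ ω n ≡ 2 ^ ω (n₀ n)) →
               ∀ i → classSize n i ≡ k * classSize (n₀ n) (cast e i)
classSize-n₀ n k n≡ e i = begin
  gcdCount (n₀ n) (d n i) n                       ≡⟨ cong (gcdCount (n₀ n) (d n i)) n≡ ⟩
  gcdCount (n₀ n) (d n i) (k * n₀ n)              ≡⟨ gcdCount-* (n₀ n) (d n i) k ⟩
  k * gcdCount (n₀ n) (d n i) (n₀ n)              ≡⟨ cong₂ (λ m δ → k * gcdCount m δ (n₀ n)) (sym (n₀-idem n))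
                                                       (lookup-orderedDivisors (primeDivisors-n₀ n) e i) ⟩
  k * classSize (n₀ n) (cast e i)                 ∎
  where open ≡-Reasoning

-- Scaling of real square roots.

≡⇒≈ : ∀ {x y} → (∀ n → seq x n ≡ seq y n) → x ≈ y
≡⇒≈ {x} {y} x≡y ε 0<ε = 0 , λ n _ → subst (λ q → ∣ q ∣ ℚ.≤ ε)
  (sym (trans (cong (ℚ._- seq y n) (x≡y n)) (ℚ.+-inverseʳ (seq y n)))) (ℚ.<⇒≤ 0<ε)

fromℕ-* : ∀ k a → fromℕ (k * a) ≈ fromℕ k *ᴿ fromℕ a
fromℕ-* k a = ≡⇒≈ {fromℕ (k * a)} {fromℕ k *ᴿ fromℕ a} λ _ → sym (frac-* k 1 a 1)

-- The approximants with denominator `L` have numerators `t` on the left and `k * s` on the right,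
-- where `s` and `t` are integer square roots. Since `k * s ≤ t ≤ k * suc s`, they differ by at most
-- `k / L`, which tends to 0.
√-*-square : ∀ k x → √ (k * k * x) ≈ fromℕ k *ᴿ √ x
√-*-square k x ε 0<ε with archimedean k ε 0<ε
... | N , k/L≤ε = N , λ l N≤l → ∣-∣-≤ (upper l N≤l) (lower l)
  where
  open +-*-Solver
  module R = ℕ.≤-Reasoning
  open ℚ.≤-Reasoning

  lower : ∀ l → + k / 1 ℚ.* √-seq x l ℚ.≤ √-seq (k * k * x) l ℚ.+ ε
  lower l = begin
    + k / 1 ℚ.* √-seq x l     ≡⟨ frac-* k 1 s L ⟩
    + (k * s) / (1 * L)       ≤⟨ frac-≤ (k * s) (1 * L) t L
                                   (ℕ.*-mono-≤ (ℕ.<⇒≤pred ks<1+t) (ℕ.≤-reflexive (sym (ℕ.*-identityˡ L)))) ⟩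
    √-seq (k * k * x) l       ≡⟨ ℚ.+-identityʳ _ ⟨
    √-seq (k * k * x) l ℚ.+ 0ℚ  ≤⟨ ℚ.+-monoʳ-≤ (√-seq (k * k * x) l) (ℚ.<⇒≤ 0<ε) ⟩
    √-seq (k * k * x) l ℚ.+ ε ∎
    where
    L = suc l
    s = √-num x l
    t = √-num (k * k * x) l
    -- Otherwise `suc t ≤ k * s`, whose square is at most `k * k * x * (L * L)`, hence below
    -- `suc t * suc t`.
    ks<1+t : k * s < suc t
    ks<1+t = ℕ.≰⇒> λ 1+t≤ks → ℕ.<-irrefl refl (R.begin-strict
      k * s * (k * s)                R.≡⟨ ℕ.[m*n]*[o*p]≡[m*o]*[n*p] k s k s ⟩
      k * k * (s * s)                R.≤⟨ ℕ.*-monoʳ-≤ (k * k) (⌊√⌋-lower (x * (L * L))) ⟩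
      k * k * (x * (L * L))          R.≡⟨ ℕ.*-assoc (k * k) x (L * L) ⟨
      k * k * x * (L * L)            R.<⟨ ⌊√⌋-upper (k * k * x * (L * L)) ⟩
      suc t * suc t                  R.≤⟨ ℕ.*-mono-≤ 1+t≤ks 1+t≤ks ⟩
      k * s * (k * s)                R.∎)

  upper : ∀ l → N ≤ l → √-seq (k * k * x) l ℚ.≤ + k / 1 ℚ.* √-seq x l ℚ.+ ε
  upper l N≤l = begin
    + t / L                                            ≤⟨ frac-≤ t L (k * s * L + k * (1 * L)) (1 * L * L) le ⟩
    + (k * s * L + k * (1 * L)) / (1 * L * L)          ≡⟨ frac-+ (k * s) (1 * L) k L ⟨
    + (k * s) / (1 * L) ℚ.+ + k / L                    ≡⟨ cong (ℚ._+ + k / L) (frac-* k 1 s L) ⟨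
    + k / 1 ℚ.* √-seq x l ℚ.+ + k / L                  ≤⟨ ℚ.+-monoʳ-≤ (+ k / 1 ℚ.* √-seq x l) (k/L≤ε l N≤l) ⟩
    + k / 1 ℚ.* √-seq x l ℚ.+ ε                        ∎
    where
    L = suc l
    s = √-num x l
    t = √-num (k * k * x) l
    t≤ : t ≤ k * suc s
    t≤ = m²≤n²⇒m≤n t (k * suc s) (R.begin
      t * t                          R.≤⟨ ⌊√⌋-lower (k * k * x * (L * L)) ⟩
      k * k * x * (L * L)            R.≡⟨ ℕ.*-assoc (k * k) x (L * L) ⟩
      k * k * (x * (L * L))          R.≤⟨ ℕ.*-monoʳ-≤ (k * k) (ℕ.<⇒≤ (⌊√⌋-upper (x * (L * L)))) ⟩
      k * k * (suc s * suc s)        R.≡⟨ ℕ.[m*n]*[o*p]≡[m*o]*[n*p] k k (suc s) (suc s) ⟩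
      k * suc s * (k * suc s)        R.∎)
    -- The factors 1 match the denominators that `frac-*` and `frac-+` produce.
    le : t * (1 * L * L) ≤ (k * s * L + k * (1 * L)) * L
    le = R.begin
      t * (1 * L * L)                R.≤⟨ ℕ.*-monoˡ-≤ (1 * L * L) t≤ ⟩
      k * suc s * (1 * L * L)        R.≡⟨ solve 3 (λ k s L → k :* (con 1 :+ s) :* (con 1 :* L :* L)
                                            := (k :* s :* L :+ k :* (con 1 :* L)) :* L) refl k s L ⟩
      (k * s * L + k * (1 * L)) * L  R.∎

fromℕ-scale : ∀ k {a b} → a ≡ k * b → fromℕ a ≈ fromℕ k *ᴿ fromℕ b
fromℕ-scale k {b = b} refl = fromℕ-* k b

√-scale : ∀ k {a b a′ b′} → a ≡ k * a′ → b ≡ k * b′ → √ (a * b) ≈ fromℕ k *ᴿ √ (a′ * b′)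
√-scale k {a′ = a′} {b′} refl refl =
  subst (λ c → √ c ≈ fromℕ k *ᴿ √ (a′ * b′)) (ℕ.[m*n]*[o*p]≡[m*o]*[n*p] k k a′ b′) (√-*-square k (a′ * b′))

-- Comparison of the matrices entry by entry.

Q̃-scale : ∀ m n k (e : 2 ^ ω m ≡ 2 ^ ω n) →
  (∀ i → d m i ≡ d n (cast e i)) → φ m ≡ k * φ n →
  (∀ i → classSize m i ≡ k * classSize n (cast e i)) →
  ∀ i j → Q̃ m i j ≈ fromℕ k *ᴿ Q̃ n (cast e i) (cast e j)
Q̃-scale m n k e d≡ φ≡ c≡ i j
  -- `Q̃` branches on `toℕ` of its indices. Matching the `toℕ-cast` equations with `refl` forces the
  -- cast indices into the same branch.
  with toℕ i | toℕ j | toℕ (cast e i) | toℕ (cast e j) | toℕ-cast e i | toℕ-cast e j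
... | zero  | zero  | _ | _ | refl | refl = fromℕ-scale k φ≡
... | zero  | suc _ | _ | _ | refl | refl = √-scale k φ≡ (c≡ j)
... | suc _ | zero  | _ | _ | refl | refl = √-scale k φ≡ (c≡ i)
... | suc _ | suc _ | _ | _ | refl | refl
  -- Both matrices make the same decisions, since `cast e` is injective and the divisors agree;
  -- mixed cases are contradictory. Zero entries scale because `k * 0` is 0.
  with i Fin.≟ j | gcd (d m i) (d m j) ℕ.≟ 1 | cast e i Fin.≟ cast e j | gcd (d n (cast e i)) (d n (cast e j)) ℕ.≟ 1
...   | yes _   | _      | yes _     | _      = fromℕ-scale k (sym (ℕ.*-zeroʳ k))
...   | yes i≡j | _      | no  i′≢j′ | _      = contradiction (cong (cast e) i≡j) i′≢j′
...   | no  i≢j | _      | yes i′≡j′ | _      = contradiction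
        (toℕ-injective (trans (sym (toℕ-cast e i)) (trans (cong toℕ i′≡j′) (toℕ-cast e j)))) i≢j
...   | no  _   | yes _  | no _      | yes _  = √-scale k (c≡ i) (c≡ j)
...   | no  _   | no  _  | no _      | no  _  = fromℕ-scale k (sym (ℕ.*-zeroʳ k))
...   | no  _   | yes g≡ | no _      | no g≢  = contradiction (trans (sym (cong₂ gcd (d≡ i) (d≡ j))) g≡) g≢
...   | no  _   | no  g≢ | no _      | yes g≡ = contradiction (trans (cong₂ gcd (d≡ i) (d≡ j)) g≡) g≢

[k*m]/m≡k : ∀ k m .{{_ : NonZero m}} → + (k * m) / m ≡ + k / 1
[k*m]/m≡k k m = ℚ.≤-antisym
  (frac-≤ (k * m) m k 1 (ℕ.≤-reflexive (ℕ.*-identityʳ (k * m))))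
  (frac-≤ k 1 (k * m) m (ℕ.≤-reflexive (sym (ℕ.*-identityʳ (k * m)))))

proposition4p2p3 : ∀ (n : ℕ) → 2 ≤ n →
    Q̃ n ≋ fromℚ (_/_ (+ n) (n₀ n) {{n₀-nonZero n}}) ∙ Q̃ (n₀ n)
proposition4p2p3 n 2≤n = e , λ i j →
  subst (λ q → Q̃ n i j ≈ fromℚ q *ᴿ Q̃ (n₀ n) (cast e i) (cast e j)) (sym n/n₀≡k)
    (Q̃-scale n (n₀ n) k e (lookup-orderedDivisors (primeDivisors-n₀ n) e)
      (φ-n₀ n k n≡) (classSize-n₀ n k n≡ e) i j)
  where
  instance
    n≢0 : NonZero n
    n≢0 = ℕ.>-nonZero (ℕ.<⇒≤ 2≤n)
    n₀≢0 : NonZero (n₀ n)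
    n₀≢0 = n₀-nonZero n
  k = quotient (n₀∣n n)
  n≡ : n ≡ k * n₀ n
  n≡ = m∣n⇒n≡quotient*m (n₀∣n n)
  e : 2 ^ ω n ≡ 2 ^ ω (n₀ n)
  e = cong (λ ps → 2 ^ length ps) (primeDivisors-n₀ n)
  -- The scalar is the rational `n / n₀`, while `Q̃-scale` yields `fromℕ k`, which is
  -- `fromℚ (+ k / 1)`.
  n/n₀≡k : + n / n₀ n ≡ + k / 1
  n/n₀≡k = trans (ℚ./-cong (cong +_ n≡) refl) ([k*m]/m≡k k (n₀ n))
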